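{- For every integer $n\ge 3$, $\tilde{r}(C_3,P_n)\le 3n-4$.
   Context: For graphs $H_1,H_2$, the online size Ramsey game is played on the edge set of the complete graph $K_{\mathbb N}$ on vertex set $\mathbb N$: in each round Builder selects a previously unselected edge and Painter colours it red or blue. The game ends as soon as, after Painter's move, there is a red copy of $H_1$ or a blue copy of $H_2$. Builder aims to end the game as quickly as possible, Painter to delay it. The online size Ramsey number $\tilde{r}(H_1,H_2)$ is the number of rounds the game lasts when both players play optimally. $C_3$ is the triangle and $P_n$ is the path on $n$ vertices. -}

module Defs where

open import Data.Nat using (ℕ; zero; suc)
open import Data.Fin using (Fin; toℕ)
open import Data.Product using (Σ; _×_; _,_)
open import Data.Sum using (_⊎_)
open import Data.List using (List; []; _∷_)
open import Data.List.Membership.Propositional using (_∈_)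
open import Relation.Nullary using (¬_)
open import Relation.Binary.PropositionalEquality using (_≡_; _≢_)
open import Function.Definitions using (Injective)

data Colour : Set where
  red blue : Colour

-- A move of the game: Builder's (undirected) edge {u,v} of K_ℕ and Painter's colour.
Move : Set
Move = ℕ × ℕ × Colour

-- The history of the game so far (most recent move first).
History : Set
History = List Move

HasEdge : History → ℕ → ℕ → Colour → Set
HasEdge H u v c = ((u , v , c) ∈ H) ⊎ ((v , u , c) ∈ H)

Selected : History → ℕ → ℕ → Set
Selected H u v = Σ Colour (HasEdge H u v)

RedC3 : History → Set
RedC3 H = Σ ℕ λ a → Σ ℕ λ b → Σ ℕ λ c →
  (a ≢ b) × (b ≢ c) × (a ≢ c) ×
  HasEdge H a b red × HasEdge H b c red × HasEdge H a c red

BlueP : ℕ → History → Set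
BlueP n H = Σ (Fin n → ℕ) λ f → Injective _≡_ _≡_ f ×
  (∀ (i j : Fin n) → suc (toℕ i) ≡ toℕ j → HasEdge H (f i) (f j) blue)

Ended : ℕ → History → Set
Ended n H = RedC3 H ⊎ BlueP n H

data BuilderWinsWithin (n : ℕ) : ℕ → History → Set where
  done : ∀ {k H} → Ended n H → BuilderWinsWithin n k H
  step : ∀ {k H} (u v : ℕ) → u ≢ v → ¬ Selected H u v →
         (∀ (c : Colour) → BuilderWinsWithin n k ((u , v , c) ∷ H)) →
         BuilderWinsWithin n (suc k) H

OnlineRamseyC3P≤ : ℕ → ℕ → Set
OnlineRamseyC3P≤ n k = BuilderWinsWithin n k []

{-# OPTIONS --safe #-}
module Submission where

-- Builder mainly maintains two disjoint blue paths P (ending in b) and Q (from d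
-- to c) with bc red.  With a new vertex z he asks dz.  Blue lengthens Q for one
-- edge.  After red he asks bz: blue lengthens P for two edges, and the ends z and d
-- are again joined in red; after red, bd is forced blue by z and cz by b, so P and Q
-- merge at a profit.  Since P costs two edges and Q one edge per vertex, this takes
-- about 3n edges.  The constant is saved by postponing edges that a common red
-- neighbour forces to be blue, as they may never be needed: P may lack the edge at
-- its end away from b, and a merged path stays broken between b and d while z serves
-- to insert further vertices into the gap.

open import Defs
open import Data.Nat using (ℕ; zero; suc; _+_; _*_; _∸_; _≤_; _<_; z≤n; s≤s)
open import Data.Nat.Properties
open import Data.Nat.Induction using (<-rec)
open import Data.Nat.Tactic.RingSolver using (solve-∀)
open import Data.Empty using (⊥-elim)
open import Data.Fin using (Fin; zero; suc; toℕ; inject≤)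
open import Data.Fin.Properties using (toℕ-inject≤; inject≤-injective)
open import Data.List using (List; []; _∷_; [_]; _++_; length; lookup; reverse)
open import Data.List.Extrema.Nat using (max; xs≤max)
open import Data.List.Membership.Propositional using (_∈_)
open import Data.List.Membership.Propositional.Properties using (∈-++⁺ˡ; ∈-++⁺ʳ; ∈-lookup)
open import Data.List.Properties using (length-++; length-reverse; unfold-reverse; ++-assoc; ∷ʳ-++)
open import Data.List.Relation.Binary.Permutation.Propositional using (_↭_; ↭-sym; ↭-trans; ↭-reflexive; ↭⇒↭ₛ)
open import Data.List.Relation.Binary.Permutation.Propositional.Properties using (shift; ++-comm; ++⁺ˡ; ↭-reverse; ↭-length)
open import Data.List.Relation.Unary.All as All using (All; []; _∷_)
import Data.List.Relation.Unary.All.Properties as All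
open import Data.List.Relation.Unary.Any using (here; there)
open import Data.List.Relation.Unary.Unique.Propositional using (Unique; []; _∷_)
open import Data.Product using (∃; _×_; _,_)
open import Data.Product.Properties using (≡-dec)
open import Data.Sum using (inj₁; inj₂; map; swap)
open import Relation.Nullary using (Dec; yes; no)
open import Relation.Nullary.Decidable using (_⊎-dec_)
open import Relation.Binary.PropositionalEquality using (_≡_; _≢_; refl; sym; trans; cong; subst; setoid; ≢-sym)
import Data.List.Membership.DecPropositional as DecMembership
import Data.List.Relation.Binary.Permutation.Setoid.Properties as Permutationₛ

variable
  H H′ : History
  k k′ n u v w x y z : ℕ
  xs ys zs : List ℕ
  c : Colour

-- Lists without repetition and their rearrangements.

Unique-resp-↭ : xs ↭ ys → Unique xs → Unique ys
Unique-resp-↭ p = Permutationₛ.Unique-resp-↭ (setoid ℕ) (↭⇒↭ₛ p)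

Unique-++⁻ˡ : ∀ xs → Unique (xs ++ ys) → Unique xs
Unique-++⁻ˡ []       _        = []
Unique-++⁻ˡ (x ∷ xs) (p ∷ ps) = All.++⁻ˡ xs p ∷ Unique-++⁻ˡ xs ps

Unique-++⁻ʳ : ∀ xs → Unique (xs ++ ys) → Unique ys
Unique-++⁻ʳ []       p        = p
Unique-++⁻ʳ (x ∷ xs) (_ ∷ ps) = Unique-++⁻ʳ xs ps

Unique-++⇒≢ : Unique (xs ++ ys) → x ∈ xs → y ∈ ys → x ≢ y
Unique-++⇒≢ {xs = _ ∷ xs} (p ∷ _)  (here refl) y∈ = All.lookup p (∈-++⁺ʳ xs y∈)
Unique-++⇒≢               (_ ∷ ps) (there x∈)  y∈ = Unique-++⇒≢ ps x∈ y∈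

lookup-injective : Unique xs → ∀ i j → lookup xs i ≡ lookup xs j → i ≡ j
lookup-injective (_ ∷ _)  zero    zero    _  = refl
lookup-injective (p ∷ _)  zero    (suc j) eq = ⊥-elim (All.lookup p (∈-lookup j) eq)
lookup-injective (p ∷ _)  (suc i) zero    eq = ⊥-elim (All.lookup p (∈-lookup i) (sym eq))
lookup-injective (_ ∷ ps) (suc i) (suc j) eq = cong suc (lookup-injective ps i j eq)

↭-append : ∀ (z : ℕ) xs → z ∷ xs ↭ xs ++ [ z ]
↭-append z xs = ++-comm [ z ] xs

↭-append₂ : ∀ (z : ℕ) xs ys → z ∷ xs ++ ys ↭ xs ++ (ys ++ [ z ])
↭-append₂ z xs ys = ↭-trans (↭-append z (xs ++ ys)) (↭-reflexive (++-assoc xs ys [ z ]))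

↭-insert : ∀ (z : ℕ) xs ys → z ∷ xs ++ ys ↭ (xs ++ [ z ]) ++ ys
↭-insert z xs ys = ↭-trans (↭-sym (shift z xs ys)) (↭-reflexive (sym (∷ʳ-++ xs z ys)))

length-grow : z ∷ xs ↭ ys → length xs + suc k ≡ n → length ys + k ≡ n
length-grow {xs = xs} {k = k} p eq =
  trans (cong (_+ k) (sym (↭-length p))) (trans (sym (+-suc (length xs) k)) eq)

+0≡⇒≤ : x + 0 ≡ n → n ≤ x
+0≡⇒≤ eq = ≤-reflexive (trans (sym eq) (+-identityʳ _))

-- Abstract, since a with-abstraction would otherwise normalise the maximum.
abstract
  fresh : (xs : List ℕ) → ∃ λ (z : ℕ) → Unique xs → Unique (z ∷ xs)
  fresh xs = suc (max 0 xs) , λ u →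
    All.map (λ x≤m m≡x → <⇒≢ (s≤s x≤m) (sym m≡x)) (xs≤max 0 xs) ∷ u

-- Asking for edges and forcing them blue.

Edge : History → ℕ → ℕ → Colour → Set
Edge H u v c = u ≢ v × HasEdge H u v c

flip-edge : Edge H u v c → Edge H v u c
flip-edge (u≢v , e) = ≢-sym u≢v , swap e

_≼_ : History → History → Set
H ≼ H′ = ∀ {u v c} → Edge H u v c → Edge H′ u v c

triangle : Edge H u v red → Edge H v w red → Edge H u w red → BuilderWinsWithin n k H
triangle (p , e) (q , f) (r , g) = done (inj₁ (_ , _ , _ , p , q , r , e , f , g))

weaken : k ≤ k′ → BuilderWinsWithin n k H → BuilderWinsWithin n k′ H
weaken _       (done e)            = done e
weaken (s≤s p) (step u v u≢v ¬s f) = step u v u≢v ¬s (λ c → weaken p (f c))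

cast : k ≡ k′ → BuilderWinsWithin n k H → BuilderWinsWithin n k′ H
cast eq = weaken (≤-reflexive eq)

_≟ᶜ_ : (c c′ : Colour) → Dec (c ≡ c′)
red  ≟ᶜ red  = yes refl
red  ≟ᶜ blue = no λ ()
blue ≟ᶜ red  = no λ ()
blue ≟ᶜ blue = yes refl

hasEdge? : ∀ H u v c → Dec (HasEdge H u v c)
hasEdge? H u v c = ((u , v , c) ∈? H) ⊎-dec ((v , u , c) ∈? H)
  where open DecMembership (≡-dec _≟_ (≡-dec _≟_ _≟ᶜ_)) using (_∈?_)

-- If the edge is already coloured, its colour is known for free; hence
-- strategies never need to argue that the edges they ask for are new.
ask : u ≢ v →
      (∀ {H′} → H ≼ H′ → Edge H′ u v red  → BuilderWinsWithin n k H′) →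
      (∀ {H′} → H ≼ H′ → Edge H′ u v blue → BuilderWinsWithin n k H′) →
      BuilderWinsWithin n (suc k) H
ask {u} {v} {H} u≢v onRed onBlue with hasEdge? H u v red | hasEdge? H u v blue
... | yes e | _     = weaken (n≤1+n _) (onRed (λ f → f) (u≢v , e))
... | no _  | yes e = weaken (n≤1+n _) (onBlue (λ f → f) (u≢v , e))
... | no ¬r | no ¬b = step u v u≢v (λ { (red , e) → ¬r e ; (blue , e) → ¬b e })
  λ { red  → onRed  later (u≢v , inj₁ (here refl))
    ; blue → onBlue later (u≢v , inj₁ (here refl)) }
  where
  later : ∀ {m} → H ≼ (m ∷ H)
  later (p , e) = p , map there there e

-- A red answer would close a red triangle with `w`.
force : u ≢ v → Edge H w u red → Edge H w v red →
        (∀ {H′} → H ≼ H′ → Edge H′ u v blue → BuilderWinsWithin n k H′) →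
        BuilderWinsWithin n (suc k) H
force u≢v wu wv = ask u≢v (λ up uv → triangle (up wu) uv (up wv))

-- Blue paths, possibly with an owed first edge.

data Walk (H : History) : ℕ → List ℕ → ℕ → Set where
  stop : Walk H x [ x ] x
  _∷_ : Edge H x y blue → Walk H y ys z → Walk H x (x ∷ ys) z

lift : H ≼ H′ → Walk H x xs y → Walk H′ x xs y
lift up stop    = stop
lift up (e ∷ p) = up e ∷ lift up p

join : Walk H x xs y → Edge H y u blue → Walk H u ys v → Walk H x (xs ++ ys) v
join stop    e q = e ∷ q
join (f ∷ p) e q = f ∷ join p e q

snoc : Walk H x xs y → Edge H y z blue → Walk H x (xs ++ [ z ]) z
snoc p e = join p e stop

rev : Walk H x xs y → Walk H y (reverse xs) x
rev stop = stop
rev {xs = x ∷ xs} (e ∷ p) rewrite unfold-reverse x xs = snoc (rev p) (flip-edge e)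

start-∈ : Walk H x xs y → x ∈ xs
start-∈ stop    = here refl
start-∈ (e ∷ p) = here refl

end-∈ : Walk H x xs y → y ∈ xs
end-∈ stop    = here refl
end-∈ (e ∷ p) = there (end-∈ p)

nonempty : Walk H x xs y → 1 ≤ length xs
nonempty stop    = s≤s z≤n
nonempty (_ ∷ _) = s≤s z≤n

walk-edge : Walk H x xs y → (i j : Fin (length xs)) → suc (toℕ i) ≡ toℕ j →
            HasEdge H (lookup xs i) (lookup xs j) blue
walk-edge ((_ , e) ∷ stop)    zero    (suc zero) _  = e
walk-edge ((_ , e) ∷ (_ ∷ _)) zero    (suc zero) _  = e
walk-edge (_ ∷ p)             (suc i) (suc j)    eq = walk-edge p i j (suc-injective eq)
walk-edge stop                zero    zero       ()

long-walk : Walk H x xs y → Unique xs → n ≤ length xs → BuilderWinsWithin n k H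
long-walk {xs = xs} p u n≤ = done (inj₂ (f , inj , edge))
  where
  -- A path that is too long is cut down to its first `n` vertices.
  f = λ i → lookup xs (inject≤ i n≤)
  inj : ∀ {i j} → f i ≡ f j → i ≡ j
  inj eq = inject≤-injective n≤ n≤ _ _ (lookup-injective u _ _ eq)
  edge : ∀ i j → suc (toℕ i) ≡ toℕ j → HasEdge _ (f i) (f j) blue
  edge i j eq = walk-edge p _ _
    (trans (cong suc (toℕ-inject≤ i n≤)) (trans eq (sym (toℕ-inject≤ j n≤))))

-- A blue path whose first edge may still have to be asked for, w forcing it blue.
data Almost (H : History) : List ℕ → ℕ → Set where
  whole : Walk H x xs y → Almost H xs y
  owed  : v ≢ x → Edge H w v red → Edge H w x red → Walk H x xs y → Almost H (v ∷ xs) y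

lift-almost : H ≼ H′ → Almost H xs y → Almost H′ xs y
lift-almost up (whole p)          = whole (lift up p)
lift-almost up (owed v≢x wv wx p) = owed v≢x (up wv) (up wx) (lift up p)

snoc-almost : Almost H xs y → Edge H y z blue → Almost H (xs ++ [ z ]) z
snoc-almost (whole p)          e = whole (snoc p e)
snoc-almost (owed v≢x wv wx p) e = owed v≢x wv wx (snoc p e)

almost-end-∈ : Almost H xs y → y ∈ xs
almost-end-∈ (whole p)      = end-∈ p
almost-end-∈ (owed _ _ _ p) = there (end-∈ p)

settle : Almost H xs y →
         (∀ {H′ x} → H ≼ H′ → Walk H′ x xs y → BuilderWinsWithin n k H′) →
         BuilderWinsWithin n (suc k) H
settle (whole p)          f = weaken (n≤1+n _) (f (λ e → e) p)
settle (owed v≢x wv wx p) f = force v≢x wv wx λ up vx → f up (vx ∷ lift up p)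

-- Serves when no round can be spent on the owed edge: giving up the vertex at that edge costs at
-- most one vertex.
core : Almost H xs y → ∃ λ vs → ∃ λ zs → ∃ λ x →
       Walk H x zs y × xs ≡ vs ++ zs × length xs ≤ suc (length zs)
core (whole p)      = [] , _ , _ , p , refl , n≤1+n _
core (owed _ _ _ p) = [ _ ] , _ , _ , p , refl , ≤-refl

-- Builder's strategy and its round budgets.

module Strategy (m : ℕ) where

  Win : ℕ → History → Set
  Win = BuilderWinsWithin (3 + m)

  -- The index l counts missing vertices.  With n = 3 + m and p = n − l, the number of
  -- rounds left is 3n − 4 minus a cost of 2p − 3 for a path on p vertices.
  OnePath : ℕ → Set
  OnePath l = ∀ {H x X y} → Walk H x X y → Unique X → length X + l ≡ 3 + m →
    Win (2 + m + 2 * l) H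

  -- The only edge missing is bd, which u forces to be blue.
  BrokenPath : ℕ → Set
  BrokenPath l = ∀ {H x X b d Y u} → Walk H x X b → Walk H d Y u →
    Edge H u b red → Edge H u d red → Unique (X ++ Y) →
    length (X ++ Y) + l ≡ 3 + m → Win (2 + m + 2 * l) H

  -- Here p = n − 1 − i and q = n − 1 − j vertices may have cost 2p + q − 3 rounds.
  TwoPaths : ℕ → ℕ → Set
  TwoPaths i j = ∀ {H P b d Q c} → Almost H P b → Walk H d Q c →
    Edge H b c red → Unique (P ++ Q) →
    length P + suc i ≡ 3 + m → length Q + suc j ≡ 3 + m → Win (2 + (2 * i + j)) H

  TwoPathsBelow : ℕ → Set
  TwoPathsBelow l = ∀ {i} → i < l → ∀ j → TwoPaths i j

  -- Builder joins the end to a new vertex. Blue takes one of the two rounds budgeted per vertex.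
  -- Red makes `z` a one-vertex `Q`, for which `j` is `suc m`, and the budgets agree exactly.
  one-path : ∀ l → TwoPathsBelow l → OnePath l
  one-path zero _ p uniq len = long-walk p uniq (+0≡⇒≤ len)
  one-path (suc l) two {X = X} p uniq len with fresh X
  ... | z , new with new uniq
  ... | uniq′@(z∉X ∷ _) = cast (budget l m) (ask (≢-sym (All.lookup z∉X (end-∈ p)))
    (λ up yz → cast (budget′ l m) (two (n<1+n l) (suc m) (whole (lift up p)) stop yz
      (Unique-resp-↭ (↭-append z X) uniq′) len refl))
    (λ up yz → weaken (n≤1+n _) (one-path l (λ i<l → two (m<n⇒m<1+n i<l))
      (snoc (lift up p) yz) (Unique-resp-↭ (↭-append z X) uniq′)
      (length-grow (↭-append z X) len))))
    where
    budget : ∀ l m → 4 + m + 2 * l ≡ 2 + m + 2 * suc l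
    budget = solve-∀
    budget′ : ∀ l m → 2 + (2 * l + suc m) ≡ 3 + m + 2 * l
    budget′ = solve-∀

  -- Either answer to `uz` adds `z` in two rounds. After red, `u` forces `bz`, and the gap moves to
  -- `zd`, still forced by `u`. After blue, `z` follows `u` and the second round closes the gap.
  broken-path : ∀ l → TwoPathsBelow l → BrokenPath l
  broken-path zero _ p q ub ud uniq len =
    force (Unique-++⇒≢ uniq (end-∈ p) (start-∈ q)) ub ud λ up bd →
      long-walk (join (lift up p) bd (lift up q)) uniq (+0≡⇒≤ len)
  broken-path (suc l) two {X = X} {Y = Y} p q ub ud uniq len with fresh (X ++ Y)
  ... | z , new with new uniq
  ... | uniq′@(z∉ ∷ _) = cast (budget l m) (ask (≢-sym (All.lookup z∉ (∈-++⁺ʳ X (end-∈ q))))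
    (λ up uz → force (≢-sym (All.lookup z∉ (∈-++⁺ˡ (end-∈ p)))) (up ub) uz λ up′ bz →
      broken-path l two′ (snoc (lift up′ (lift up p)) bz) (lift up′ (lift up q))
        (up′ uz) (up′ (up ud)) (Unique-resp-↭ (↭-insert z X Y) uniq′)
        (length-grow (↭-insert z X Y) len))
    (λ up uz → force (Unique-++⇒≢ uniq (end-∈ p) (start-∈ q)) (up ub) (up ud) λ up′ bd →
      one-path l two′ (join (lift up′ (lift up p)) bd (snoc (lift up′ (lift up q)) (up′ uz)))
        (Unique-resp-↭ (↭-append₂ z X Y) uniq′) (length-grow (↭-append₂ z X Y) len)))
    where
    two′ : TwoPathsBelow l
    two′ i<l = two (m<n⇒m<1+n i<l)
    budget : ∀ l m → 4 + m + 2 * l ≡ 2 + m + 2 * suc l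
    budget = solve-∀

  -- The two rounds already spent pay for lowering `i` by one. `Q` is reversed because `dz` now
  -- joins the ends in red.
  grow-first : ∀ {b d c z P Q} i → TwoPathsBelow i → ∀ j → 0 < i + j →
    Almost H P b → Walk H d Q c → Edge H d z red → Edge H b z blue → Unique (z ∷ P ++ Q) →
    length P + suc i ≡ 3 + m → length Q + suc j ≡ 3 + m → Win (2 * i + j) H
  -- From `0 < i + j`, `j` is positive here, which leaves a round for an owed edge of `P`.
  grow-first {z = z} {P} {Q} zero _ (suc j) _ p q dz bz uniq lenP lenQ =
    settle (snoc-almost p bz) λ up p′ →
      long-walk p′ (Unique-++⁻ˡ (P ++ [ z ]) (Unique-resp-↭ (↭-insert z P Q) uniq))
        (+0≡⇒≤ (length-grow (↭-append z P) lenP))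
  grow-first {z = z} {P} {Q} (suc i) below j _ p q dz bz uniq lenP lenQ =
    cast (budget i j) (below (n<1+n i) j (snoc-almost p bz) (rev q) (flip-edge dz)
      (Unique-resp-↭ (↭-trans (↭-insert z P Q) (++⁺ˡ (P ++ [ z ]) (↭-sym (↭-reverse Q)))) uniq)
      (length-grow (↭-append z P) lenP)
      (trans (cong (_+ suc j) (length-reverse Q)) lenQ))
    where
    budget : ∀ i j → 2 + (2 * i + j) ≡ 2 * suc i + j
    budget = solve-∀

  meet : ∀ {b d c z P Q} i → TwoPathsBelow i → ∀ j → 0 < i + j →
    Almost H P b → Walk H d Q c → Edge H b c red → Edge H d z red → Edge H b z red →
    Unique (z ∷ P ++ Q) →
    length P + suc i ≡ 3 + m → length Q + suc j ≡ 3 + m → Win (2 * i + j) H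
  -- Here `c` is `d`, so the three red edges form a triangle.
  meet i _ j _ p stop bc dz bz _ _ _ = triangle bc dz bz
  -- Only one round is certain, and `bd` takes it. A vertex lost with an owed edge is made up for by
  -- `Q`, which has at least two vertices.
  meet {P = P} {Q = Q@(d ∷ _)} zero _ (suc j) _ p q@(_ ∷ q′) bc dz bz (_ ∷ uniq) lenP lenQ
    with core p
  ... | vs , zs , _ , p′ , refl , P≤ =
    force (Unique-++⇒≢ uniq (almost-end-∈ p) (start-∈ q)) (flip-edge bz) (flip-edge dz) λ up bd →
      long-walk (join (lift up p′) bd (lift up q))
        (Unique-++⁻ʳ vs (subst Unique (++-assoc vs zs Q) uniq))
        (begin
          3 + m                  ≡⟨ lenP ⟨
          length P + 1           ≤⟨ +-monoˡ-≤ 1 P≤ ⟩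
          suc (length zs) + 1    ≡⟨ +-suc (length zs) 1 ⟨
          length zs + 2          ≤⟨ +-monoʳ-≤ (length zs) (s≤s (nonempty q′)) ⟩
          length zs + length Q   ≡⟨ length-++ zs ⟨
          length (zs ++ Q)       ∎)
    where open ≤-Reasoning
  meet {P = P} {Q = Q@(d ∷ Q′)} (suc i) below j _ p q@(_ ∷ q′) bc dz bz uniq′@(z∉ ∷ uniq) lenP lenQ
    with <-≤-connex (suc i) (length Q)
  -- `P` and `Q` together have `n` vertices: `bd` and a possibly owed edge finish the game.
  ... | inj₁ i<Q = cast (budget i j)
    (force (Unique-++⇒≢ uniq (almost-end-∈ p) (start-∈ q)) (flip-edge bz) (flip-edge dz) λ up bd →
      settle (lift-almost up p) λ up′ p′ →
        long-walk (join p′ (up′ bd) (lift up′ (lift up q))) uniq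
          (begin
            3 + m                   ≡⟨ lenP ⟨
            length P + suc (suc i)  ≤⟨ +-monoʳ-≤ (length P) i<Q ⟩
            length P + length Q     ≡⟨ length-++ P ⟨
            length (P ++ Q)         ∎))
    where
    open ≤-Reasoning
    budget : ∀ i j → 2 + (2 * i + j) ≡ 2 * suc i + j
    budget = solve-∀
  -- Otherwise `bd` stays open: `cz` appends `z` to `Q`, and `z`, red to both `b` and `d`, becomes
  -- the `u` of a broken path lacking `l` vertices.
  ... | inj₂ Q≤i with m≤n⇒∃[o]m+o≡n Q≤i
  ... | l , eq = weaken enough
    (settle p λ up p′ →
      force (≢-sym (All.lookup z∉ (∈-++⁺ʳ P (end-∈ q)))) (up bc) (up bz) λ up′ cz →
        broken-path l (λ i<l → below (<-≤-trans i<l l≤i)) (lift up′ p′)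
          (snoc (lift up′ (lift up q)) cz)
          (flip-edge (up′ (up bz))) (flip-edge (up′ (up dz)))
          (Unique-resp-↭ (↭-append₂ _ P Q) uniq′)
          (length-grow (↭-append₂ _ P Q) len))
    where
    open ≤-Reasoning
    l≤i : l ≤ suc i
    l≤i = subst (l ≤_) eq (m≤n+m l (length Q))
    regroup : ∀ a b l → (a + b) + suc l ≡ a + suc (b + l)
    regroup = solve-∀
    len : length (P ++ Q) + suc l ≡ 3 + m
    len = begin-equality
      length (P ++ Q) + suc l          ≡⟨ cong (_+ suc l) (length-++ P) ⟩
      (length P + length Q) + suc l    ≡⟨ regroup (length P) (length Q) l ⟩
      length P + suc (length Q + l)    ≡⟨ cong (λ i → length P + suc i) eq ⟩
      length P + suc (suc i)           ≡⟨ lenP ⟩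
      3 + m                            ∎
    budget : ∀ q j l → 1 + (suc q + suc j) + 2 * l + q ≡ 2 * (suc q + l) + j + 1
    budget = solve-∀
    -- The right side exceeds the left by `length Q` minus 2, hence the appeal to a second vertex of
    -- `Q`.
    enough : 4 + m + 2 * l ≤ 2 * suc i + j
    enough = +-cancelʳ-≤ 1 _ _ (begin
      1 + (3 + m) + 2 * l + 1                           ≡⟨ cong (λ n → 1 + n + 2 * l + 1) lenQ ⟨
      1 + (length Q + suc j) + 2 * l + 1                ≤⟨ +-monoʳ-≤ (1 + (length Q + suc j) + 2 * l) (nonempty q′) ⟩
      1 + (length Q + suc j) + 2 * l + length Q′        ≡⟨ budget (length Q′) j l ⟩
      2 * (length Q + l) + j + 1                        ≡⟨ cong (λ i → 2 * i + j + 1) eq ⟩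
      2 * suc i + j + 1                                 ∎)

  -- A blue `dz` lowers `j` at the same `i`, which is the case `next`. Passing it as an argument
  -- keeps the recursion of `two-paths-step` structural in `j`; for `j = 0` it is vacuous, and blue
  -- completes `Q`.
  extend : ∀ i → TwoPathsBelow i → ∀ j → 0 < i + j →
    (∀ {j′} → j ≡ suc j′ → TwoPaths i j′) → TwoPaths i j
  extend i below j i+j>0 next {P = P} {Q = Q} p q bc uniq lenP lenQ with fresh (P ++ Q)
  ... | z , new with new uniq
  ... | uniq′@(z∉ ∷ _) = ask (≢-sym (All.lookup z∉ (∈-++⁺ʳ P (start-∈ q))))
    (λ up dz → ask (≢-sym (All.lookup z∉ (∈-++⁺ˡ (almost-end-∈ p))))
      (λ up′ bz → meet i below j i+j>0 (lift-almost up′ (lift-almost up p)) (lift up′ (lift up q))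
        (up′ (up bc)) (up′ dz) bz uniq′ lenP lenQ)
      (λ up′ bz → grow-first i below j i+j>0 (lift-almost up′ (lift-almost up p)) (lift up′ (lift up q))
        (up′ dz) bz uniq′ lenP lenQ))
    (λ up dz → grow-second j next (lift-almost up p) (flip-edge dz ∷ lift up q) (up bc) lenQ)
    where
    uniq″ : Unique (P ++ z ∷ Q)
    uniq″ = Unique-resp-↭ (↭-sym (shift z P Q)) uniq′
    grow-second : ∀ {H b c} j → (∀ {j′} → j ≡ suc j′ → TwoPaths i j′) →
      Almost H P b → Walk H z (z ∷ Q) c → Edge H b c red → length Q + suc j ≡ 3 + m →
      Win (suc (2 * i + j)) H
    grow-second zero _ p q _ lenQ =
      long-walk q (Unique-++⁻ʳ P uniq″) (+0≡⇒≤ (trans (sym (+-suc _ 0)) lenQ))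
    grow-second (suc j) next p q bc lenQ = cast (cong suc (sym (+-suc (2 * i) j)))
      (next refl p q bc uniq″ lenP (trans (sym (+-suc _ (suc j))) lenQ))

  two-paths-step : ∀ i → TwoPathsBelow i → ∀ j → TwoPaths i j
  -- With two rounds left, Builder starts at `b` instead of `d`: after red, `b` forces `cz`,
  -- completing `Q`; blue completes `P` up to an owed edge, which takes the last round.
  two-paths-step zero _ zero {P = P} {Q = Q} p q bc uniq lenP lenQ with fresh (P ++ Q)
  ... | z , new with new uniq
  ... | uniq′@(z∉ ∷ _) = ask (≢-sym (All.lookup z∉ (∈-++⁺ˡ (almost-end-∈ p))))
    (λ up bz → force (≢-sym (All.lookup z∉ (∈-++⁺ʳ P (end-∈ q)))) (up bc) bz λ up′ cz →
      long-walk (snoc (lift up′ (lift up q)) cz)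
        (Unique-++⁻ʳ P (Unique-resp-↭ (↭-append₂ z P Q) uniq′))
        (+0≡⇒≤ (length-grow (↭-append z Q) lenQ)))
    (λ up bz → settle (snoc-almost (lift-almost up p) bz) λ up′ p′ →
      long-walk p′ (Unique-++⁻ˡ (P ++ [ z ]) (Unique-resp-↭ (↭-insert z P Q) uniq′))
        (+0≡⇒≤ (length-grow (↭-append z P) lenP)))
  two-paths-step zero    below (suc j) = extend zero below (suc j) (s≤s z≤n)
    λ { refl → two-paths-step zero below j }
  two-paths-step (suc i) below zero    = extend (suc i) below zero (s≤s z≤n) λ ()
  two-paths-step (suc i) below (suc j) = extend (suc i) below (suc j) (s≤s z≤n)
    λ { refl → two-paths-step (suc i) below j }

  -- Induction on `i` is strong: after a merge, a red answer can lead back to two paths with a much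
  -- smaller `i` and with `j` reset to `suc m`.
  two-paths : ∀ i j → TwoPaths i j
  two-paths = <-rec _ two-paths-step

  -- The leaves v and L of a red star with centre w; all blue edges between leaves
  -- are forced, and the one between v and the start of L is postponed.
  star : ∀ {L b} i → Walk H x L b → Edge H w v red → Edge H w x red → Edge H w b red →
    Unique (w ∷ v ∷ L) → length L + suc (suc i) ≡ 3 + m → Win (3 + m + 2 * i) H
  star {w = w} {v = v} {L = L} i p wv wx wb uniq len with fresh (w ∷ v ∷ L)
  ... | z , new with new uniq
  ... | uniq′@(z∉ ∷ _) = ask (≢-sym (All.lookup z∉ (here refl)))
    (λ up wz → force (≢-sym (All.lookup z∉ (there (there (end-∈ p))))) (up wb) wz λ up′ bz →
      add-leaf i v≢x (snoc (lift up′ (lift up p)) bz) (up′ (up wv)) (up′ (up wx)) (up′ wz)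
        (length-grow (↭-append z L) len))
    -- Blue ends the star: the leaves become `P`, owing its edge at `v`, and `z`, `w` become `Q`,
    -- whose end `w` is red to `b`.
    (λ up wz → cast (budget i m) (two-paths i m
      (owed v≢x (up wv) (up wx) (lift up p)) (flip-edge wz ∷ stop) (flip-edge (up wb))
      (Unique-resp-↭ (++-comm (z ∷ w ∷ []) (v ∷ L)) uniq′)
      (trans (sym (+-suc (length L) (suc i))) len) refl))
    where
    v≢x = Unique-++⇒≢ {xs = [ v ]} (Unique-++⁻ʳ [ w ] uniq) (here refl) (start-∈ p)
    uniq″ : Unique (w ∷ v ∷ L ++ [ z ])
    uniq″ = Unique-resp-↭ (↭-append z (w ∷ v ∷ L)) uniq′
    budget : ∀ i m → 2 + (2 * i + m) ≡ 2 + m + 2 * i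
    budget = solve-∀
    budget′ : ∀ i m → 3 + m + 2 * i ≡ 1 + m + 2 * suc i
    budget′ = solve-∀
    add-leaf : ∀ {H x} i → v ≢ x → Walk H x (L ++ [ z ]) z → Edge H w v red → Edge H w x red →
      Edge H w z red → length (L ++ [ z ]) + suc i ≡ 3 + m → Win (1 + m + 2 * i) H
    add-leaf zero v≢x p wv wx wz len = settle (owed v≢x wv wx p) λ up p′ →
      long-walk p′ (Unique-++⁻ʳ [ w ] uniq″) (≤-reflexive (trans (sym len) (+-comm _ 1)))
    add-leaf (suc i) _ p wv wx wz len = cast (budget′ i m) (star i p wv wx wz uniq″ len)

  -- If the first edge is red, one round is spent, but `two-paths` on two single vertices allows for
  -- none. A second edge at 0 repairs this: blue gives the paths 2, 0 and 1 at their exact cost of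
  -- two rounds, and red starts a star.
  opening : Win (5 + 3 * m) []
  opening = ask {u = 0} {v = 1} (λ ())
    (λ _ e₁ → ask {u = 0} {v = 2} (λ ())
      (λ up e₂ → cast (budget m) (star m stop e₂ (up e₁) (up e₁)
        (((λ ()) ∷ (λ ()) ∷ []) ∷ ((λ ()) ∷ []) ∷ [] ∷ []) refl))
      (λ up e₂ → cast (budget′ m) (two-paths m (suc m) (whole (flip-edge e₂ ∷ stop)) stop (up e₁)
        (((λ ()) ∷ (λ ()) ∷ []) ∷ ((λ ()) ∷ []) ∷ [] ∷ []) refl refl)))
    (λ _ e → cast (budget″ m) (one-path (suc m) (λ _ → two-paths _) (e ∷ stop)
      (((λ ()) ∷ []) ∷ [] ∷ []) refl))
    where
    budget : ∀ m → 3 + m + 2 * m ≡ 3 + 3 * m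
    budget = solve-∀
    budget′ : ∀ m → 2 + (2 * m + suc m) ≡ 3 + 3 * m
    budget′ = solve-∀
    budget″ : ∀ m → 2 + m + 2 * suc m ≡ 4 + 3 * m
    budget″ = solve-∀

theorem2 : ∀ (n : ℕ) → 3 ≤ n → OnlineRamseyC3P≤ n (3 * n ∸ 4)
theorem2 (suc (suc (suc m))) (s≤s (s≤s (s≤s z≤n))) =
  cast (cong (_∸ 4) (budget m)) (Strategy.opening m)
  where
  budget : ∀ m → 9 + 3 * m ≡ 3 * (3 + m)
  budget = solve-∀
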